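{- Let $k\geqslant 1$ and $\Delta\geqslant 3$ be integers. Then there are only finitely many (finite, simple, connected) graphs $G$ of maximum degree $\Delta$ such that $g_k(G)<k-2$.
   Context: For integers $k\geqslant 1$ and $\Delta\geqslant 3$, let $f(k,\Delta)=\Delta\sum_{i=0}^{k-1}(\Delta-1)^i$ (the number of non-root nodes of a $\Delta$-ary tree of height $k$). For a graph $G$, its $k$-th power $G^k$ is the graph on $V(G)$ in which two distinct vertices are adjacent iff their distance in $G$ is at most $k$. $\chi$ denotes the chromatic number and $\Delta(G)$ the maximum degree of $G$. The $k$-gap of $G$ is $g_k(G)=f(k,\Delta(G))+1-\chi(G^k)$. -}

module Defs where

open import Data.Fin using (Fin; _≟_; finToFun; funToFin)
open import Data.Fin.Properties using (any?; all?; finToFun-funToFin)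
open import Data.Integer using (ℤ; +_)
import Data.Integer as ℤ
open import Data.List using (List; length; map; filter; allFin; upTo; sum)
open import Data.List.Extrema.Nat using (max)
open import Data.List.Relation.Unary.Any using (Any)
open import Data.Nat using (ℕ; zero; suc; _+_; _*_; _∸_; _^_; _≤_; _<_; z≤n; s≤s)
open import Data.Nat.Properties using (anyUpTo?; ≤-trans)
open import Data.Product using (Σ; ∃; _×_; _,_; proj₁; proj₂)
open import Function using (id; _∘_)
open import Function.Bundles using (_⇔_; _↔_; Inverse)
open import Level using (Level; 0ℓ) renaming (suc to lsuc; _⊔_ to _⊔ˡ_)
open import Relation.Binary using (Rel; Symmetric; Decidable)
open import Relation.Binary.PropositionalEquality using (_≡_; _≢_; refl; sym; trans)
open import Relation.Nullary using (¬_; Dec; yes; no; contradiction)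
open import Relation.Nullary.Decidable using (map′; _×-dec_; _→-dec_; ¬?)
import Relation.Unary as U

IsLeast : (ℕ → Set) → ℕ → Set
IsLeast P m = P m × (∀ n → P n → m ≤ n)

least : {P : ℕ → Set} → U.Decidable P → ∀ n → P n → ∃ (IsLeast P)
least P? zero    p = zero , p , λ _ _ → z≤n
least {P} P? (suc n) p with P? zero
... | yes p₀ = zero , p₀ , λ _ _ → z≤n
... | no ¬p₀ with least (P? ∘ suc) n p
...   | m , pₘ , min = suc m , pₘ , min′
  where
  min′ : ∀ l → P l → suc m ≤ l
  min′ zero    q = contradiction q ¬p₀
  min′ (suc l) q = s≤s (min l q)

-- Finite simple graphs.  Up to isomorphism the vertex set may be taken to
-- be Fin order.
record Graph : Set₁ where
  field
    order  : ℕ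
    Adj    : Rel (Fin order) 0ℓ
    adj?   : Decidable Adj
    symm   : Symmetric Adj
    irrefl : ∀ v → ¬ Adj v v

  Vertex : Set
  Vertex = Fin order

open Graph public using (Vertex)

record _≅_ (G H : Graph) : Set where
  private
    module G = Graph G
    module H = Graph H
  field
    bijection : G.Vertex ↔ H.Vertex
    preserves : ∀ u v → G.Adj u v ⇔ H.Adj (Inverse.to bijection u) (Inverse.to bijection v)

FinitelyManyUpToIso : ∀ {ℓ} → (Graph → Set ℓ) → Set (lsuc 0ℓ ⊔ˡ ℓ)
FinitelyManyUpToIso P = Σ (List Graph) λ Hs → ∀ G → P G → Any (G ≅_) Hs

degree : (G : Graph) → Vertex G → ℕ
degree G v = length (filter (adj? v) (allFin order))
  where open Graph G

-- The value on the graph without vertices is 0.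
maxDegree : Graph → ℕ
maxDegree G = max 0 (map (degree G) (allFin (Graph.order G)))

data Walk (G : Graph) : Vertex G → Vertex G → ℕ → Set where
  []  : ∀ {u} → Walk G u u 0
  _∷_ : ∀ {u v w n} → Graph.Adj G u v → Walk G v w n → Walk G u w (suc n)

Connected : Graph → Set
Connected G = ∀ u v → ∃ (Walk G u v)

-- IsDistance G u v d: the distance from u to v is (defined and equal to) d.
IsDistance : (G : Graph) → Vertex G → Vertex G → ℕ → Set
IsDistance G u v = IsLeast (Walk G u v)

Distance≤ : (G : Graph) → ℕ → Vertex G → Vertex G → Set
Distance≤ G k u v = ∃ λ d → IsDistance G u v d × d ≤ k

walk? : (G : Graph) → ∀ u v n → Dec (Walk G u v n)
walk? G u v zero = map′ (λ { refl → [] }) (λ { [] → refl }) (u ≟ v)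
walk? G u v (suc n) =
  map′ (λ { (_ , a , p) → a ∷ p }) (λ { (a ∷ p) → _ , a , p })
       (any? λ w → Graph.adj? G u w ×-dec walk? G w v n)

distance≤? : (G : Graph) → ∀ k u v → Dec (Distance≤ G k u v)
distance≤? G k u v = map′ to from (anyUpTo? (walk? G u v) (suc k))
  where
  to : (∃ λ n → n < suc k × Walk G u v n) → Distance≤ G k u v
  to (n , s≤s n≤k , p) with least (walk? G u v) n p
  ... | d , q , min = d , (q , min) , ≤-trans (min n p) n≤k

  from : Distance≤ G k u v → ∃ λ n → n < suc k × Walk G u v n
  from (d , (q , _) , d≤k) = d , s≤s d≤k , q

walk-snoc : (G : Graph) → ∀ {u v w n} → Walk G u v n → Graph.Adj G v w → Walk G u w (suc n)
walk-snoc G []      b = b ∷ []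
walk-snoc G (a ∷ p) b = a ∷ walk-snoc G p b

walk-reverse : (G : Graph) → ∀ {u v n} → Walk G u v n → Walk G v u n
walk-reverse G []      = []
walk-reverse G (a ∷ p) = walk-snoc G (walk-reverse G p) (Graph.symm G a)

distance≤-sym : (G : Graph) → ∀ k {u v} → Distance≤ G k u v → Distance≤ G k v u
distance≤-sym G k (d , (p , min) , d≤k) =
  d , (walk-reverse G p , λ n q → min n (walk-reverse G q)) , d≤k

power : ℕ → Graph → Graph
power k G = record
  { order  = Graph.order G
  ; Adj    = λ u v → u ≢ v × Distance≤ G k u v
  ; adj?   = λ u v → ¬? (u ≟ v) ×-dec distance≤? G k u v
  ; symm   = λ { (u≢v , d) → u≢v ∘ sym , distance≤-sym G k d }
  ; irrefl = λ { v (v≢v , _) → v≢v refl }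
  }

ProperColouring : (G : Graph) (c : ℕ) → (Vertex G → Fin c) → Set
ProperColouring G c col = ∀ u v → Graph.Adj G u v → col u ≢ col v

Colourable : Graph → ℕ → Set
Colourable G c = Σ (Vertex G → Fin c) (ProperColouring G c)

colourable? : (G : Graph) → U.Decidable (Colourable G)
colourable? G c = map′ to from
  (any? λ i → all? λ u → all? λ v →
    Graph.adj? G u v →-dec ¬? (finToFun {c} {Graph.order G} i u ≟ finToFun {c} {Graph.order G} i v))
  where
  to : (∃ λ i → ProperColouring G c (finToFun i)) → Colourable G c
  to (i , proper) = finToFun i , proper

  from : Colourable G c → ∃ λ i → ProperColouring G c (finToFun i)
  from (col , proper) = funToFin col , λ u v a eq →
    proper u v a (trans (sym (finToFun-funToFin col u)) (trans eq (finToFun-funToFin col v)))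

chromatic : (G : Graph) → ∃ (IsLeast (Colourable G))
chromatic G = least (colourable? G) (Graph.order G)
  (id , λ { u .u a refl → Graph.irrefl G u a })

χ : Graph → ℕ
χ G = proj₁ (chromatic G)

f : ℕ → ℕ → ℕ
f k Δ = Δ * sum (map (λ i → (Δ ∸ 1) ^ i) (upTo k))

-- Integer-valued: both the gap and the bound k - 2 it is compared with
-- are taken without truncation.
gap : ℕ → Graph → ℤ
gap k G = + (f k (maxDegree G) + 1) ℤ.- + χ (power k G)

{-# OPTIONS --safe #-}
module Submission where

-- A graph of diameter less than 2k and bounded degree has bounded order, so it suffices to colour
-- G^k with f(k,Δ) + 3 - k colours when G contains a geodesic of length 2k.  Let r be its middle and
-- let a_j, b_j be its two vertices at distance j from r.  Give a_j and b_(k+1-j), which are at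
-- distance k + 1, the same colour, for 1 ≤ j ≤ k, and colour the other vertices greedily by
-- decreasing distance to r.  The vertices within distance k of v are the endpoints of at most
-- f(k,Δ) non-backtracking walks.  Among these (counting an absent walk as well), at least 2k - 2
-- lead to a precoloured vertex or to one closer to r than v: those along a shortest path from v to
-- r, those leaving that path by one edge, and those that follow the geodesic once the path has met
-- it.  So v sees at most f(k,Δ) - (2k - 2) colours besides the k preassigned ones.

open import Defs
open import Data.Nat using (ℕ; _≤_)
open import Data.Integer using (+_; _-_; _<_)
open import Data.Product using (_×_)
open import Relation.Binary.PropositionalEquality using (_≡_)

open import Data.Empty using (⊥)
open import Data.Fin using (Fin; zero; suc; toℕ; _≟_; fromℕ<; finToFun; funToFin)
open import Data.Fin.Properties using (any?; injective⇒≤; toℕ-injective; toℕ<n; toℕ-fromℕ<; finToFun-funToFin; ¬∀⟶∃¬)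
import Data.Integer as ℤ
import Data.Integer.Properties as ℤ
open import Data.Integer.Solver using () renaming (module +-*-Solver to ℤ-Solver)
open import Data.List using (List; []; _∷_; _++_; length; map; filter; concatMap; allFin; lookup; upTo; applyUpTo)
open import Data.List.Extrema.Nat using (max; xs≤max)
open import Data.List.Membership.DecPropositional using (_∈?_)
open import Data.List.Membership.Propositional using (_∈_; _∉_; lose)
open import Data.List.Membership.Propositional.Properties using (∈-filter⁺; ∈-filter⁻; ∈-concatMap⁺; ∈-++⁺ˡ; ∈-++⁺ʳ; ∈-allFin; ∈-map⁺; ∈-upTo⁺)
open import Data.List.Properties using (length-++; filter-notAll; length-filter; length-map; length-upTo; map-applyUpTo; map-upTo)
import Data.List.Relation.Unary.All as All
open import Data.List.Relation.Unary.Any as Any using (here; there; index)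
open import Data.List.Relation.Unary.Any.Properties using (lookup-index)
open import Data.Nat using (zero; suc; _+_; _*_; _^_; _∸_; _⊓_; z≤n; s≤s; s≤s⁻¹; _≤?_) renaming (_<_ to _<ℕ_; _<?_ to _<ℕ?_)
import Data.Nat as ℕ
open import Data.Nat.ListAction using (sum)
open import Data.Nat.Properties hiding (_≟_; _≤?_)
open import Data.Nat.Solver using (module +-*-Solver)
open import Data.Product using (∃; _,_; proj₁; proj₂)
open import Data.Sum using (_⊎_; inj₁; inj₂)
open import Data.Unit using (⊤; tt)
open import Function using (_∘_)
open import Function.Bundles using (mk⇔)
open import Function.Construct.Identity using (↔-id)
open import Relation.Binary.Definitions using (tri<; tri≈; tri>)
open import Relation.Binary.PropositionalEquality using (_≢_; refl; sym; trans; cong; cong₂; subst; subst₂)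
open import Relation.Nullary using (¬_; yes; no; contradiction)
open import Relation.Nullary.Decidable using (¬?; _×-dec_; _⊎-dec_; decidable-stable)
import Relation.Unary as U

-- Counting: lengths of concatenated lists with savings, and tree sizes.

exhaustive⇒≤length : ∀ {n} {xs : List (Fin n)} → (∀ i → i ∈ xs) → n ≤ length xs
exhaustive⇒≤length {xs = xs} all = injective⇒≤ {f = index ∘ all} λ {i} {j} eq →
  trans (lookup-index (all i)) (trans (cong (lookup xs) eq) (sym (lookup-index (all j))))

module _ {A B : Set} (g : A → List B) (b : ℕ) where

  private
    ∣_∣ : A → ℕ
    ∣ x ∣ = length (g x)

  -- `s` is a saving per element, added to the length and compared with the budget `b`, so that no
  -- truncated subtraction occurs.
  _Bounds_ : ℕ → List A → Set
  s Bounds xs = ∀ {x} → x ∈ xs → ∣ x ∣ + s ≤ b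

  private
    regroup : ∀ {x xs l m n} s t → ∣ x ∣ + s ≤ l → length (concatMap g xs) + t ≤ m → l + m ≤ n →
              length (concatMap g (x ∷ xs)) + (s + t) ≤ n
    regroup {x} {xs} {l} {m} {n} s t p q r = begin
      length (concatMap g (x ∷ xs)) + (s + t)        ≡⟨ cong (_+ (s + t)) (length-++ (g x)) ⟩
      ∣ x ∣ + length (concatMap g xs) + (s + t)       ≡⟨ +-*-Solver.solve 4 (λ a b c d → (a :+ b) :+ (c :+ d) := (a :+ c) :+ (b :+ d)) refl ∣ x ∣ (length (concatMap g xs)) s t ⟩
      (∣ x ∣ + s) + (length (concatMap g xs) + t)     ≤⟨ +-mono-≤ p q ⟩
      l + m                                         ≤⟨ r ⟩
      n                                             ∎
      where open ≤-Reasoning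
            open +-*-Solver using (_:+_; _:=_)

    weaken : ∀ {xs} → 1 Bounds xs → 0 Bounds xs
    weaken h {x} i = ≤-trans (+-monoʳ-≤ ∣ x ∣ z≤n) (h i)

  concatMap-bound : ∀ {xs} → 0 Bounds xs → length (concatMap g xs) + 0 ≤ length xs * b
  concatMap-bound {[]}     h = z≤n
  concatMap-bound {x ∷ xs} h = regroup {x} {xs} 0 0 (h (here refl)) (concatMap-bound (h ∘ there)) ≤-refl

  concatMap-bound₁ : ∀ {xs x s} → 0 Bounds xs → x ∈ xs → ∣ x ∣ + s ≤ b →
                     length (concatMap g xs) + s ≤ length xs * b
  concatMap-bound₁ {y ∷ xs} {s = s} h (here refl) p =
    subst (λ t → length (concatMap g (y ∷ xs)) + t ≤ length (y ∷ xs) * b) (+-identityʳ s)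
      (regroup {y} {xs} s 0 p (concatMap-bound (h ∘ there)) ≤-refl)
  concatMap-bound₁ {y ∷ xs} {s = s} h (there i) p =
    regroup {y} {xs} 0 s (h (here refl)) (concatMap-bound₁ (h ∘ there) i p) ≤-refl

  -- Since `x` and `y` differ they occupy different places of `xs`, so their savings add up.
  concatMap-bound₂ : ∀ {xs x y s t} → 0 Bounds xs → x ≢ y → x ∈ xs → ∣ x ∣ + s ≤ b → y ∈ xs → ∣ y ∣ + t ≤ b →
                     length (concatMap g xs) + (s + t) ≤ length xs * b
  concatMap-bound₂ h x≢y (here refl) p (here refl) q = contradiction refl x≢y
  concatMap-bound₂ {z ∷ xs} {s = s} {t} h x≢y (here refl) p (there j) q =
    regroup {z} {xs} s t p (concatMap-bound₁ (h ∘ there) j q) ≤-refl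
  concatMap-bound₂ {z ∷ xs} {s = s} {t} h x≢y (there i) p (here refl) q =
    subst (λ u → length (concatMap g (z ∷ xs)) + u ≤ length (z ∷ xs) * b) (+-comm t s)
      (regroup {z} {xs} t s q (concatMap-bound₁ (h ∘ there) i p) ≤-refl)
  concatMap-bound₂ {z ∷ xs} {s = s} {t} h x≢y (there i) p (there j) q =
    regroup {z} {xs} 0 (s + t) (h (here refl)) (concatMap-bound₂ (h ∘ there) x≢y i p j q) ≤-refl

  -- The extra unit comes from any second element, or from a second slot left empty.
  concatMap-bound-pendant : ∀ {xs x s n} → 1 Bounds xs → x ∈ xs → ∣ x ∣ + s ≤ b → 1 ≤ b →
                            length xs ≤ n → 2 ≤ n → length (concatMap g xs) + suc s ≤ n * b
  concatMap-bound-pendant {y ∷ []} {s = s} h (here refl) p 1≤b _ (s≤s (s≤s {n = n} _)) =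
    subst (λ u → length (concatMap g (y ∷ [])) + u ≤ suc (suc n) * b) (+-comm s 1)
      (regroup {y} {[]} s 1 p 1≤b (+-monoʳ-≤ b (m≤m+n b (n * b))))
  concatMap-bound-pendant {y ∷ z ∷ xs} {s = s} {n} h (here refl) p _ le _ =
    subst (λ u → length (concatMap g (y ∷ z ∷ xs)) + u ≤ n * b) (+-comm s 1)
      (regroup {y} {z ∷ xs} s 1 p
        (concatMap-bound₁ (weaken (h ∘ there)) (here refl) (h (there (here refl)))) (*-monoˡ-≤ b le))
  concatMap-bound-pendant {y ∷ xs} {s = s} h (there i) p _ le _ =
    regroup {y} {xs} 1 s (h (here refl)) (concatMap-bound₁ (weaken (h ∘ there)) i p) (*-monoˡ-≤ b le)

-- The geometric sum 1 + δ + ... + δ^(n-1) in Horner form, which matches the recursion of `branch`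
-- below. For Δ = `suc δ`, `suc δ * tree δ k` is f(k,Δ).
tree : ℕ → ℕ → ℕ
tree δ zero    = 0
tree δ (suc n) = suc (δ * tree δ n)

-- Non-backtracking walks and their savings.

neighbours : (G : Graph) → Vertex G → List (Vertex G)
neighbours G v = filter (Graph.adj? G v) (allFin (Graph.order G))

module Branches (G : Graph) (δ : ℕ) (degree≤ : ∀ v → degree G v ≤ suc δ)
                {P : Vertex G → Set} (P? : U.Decidable P) where
  open Graph G using (Adj; adj?; symm)

  children : Vertex G → Vertex G → List (Vertex G)
  children p w = filter (λ x → ¬? (x ≟ p)) (neighbours G w)

  -- The endpoints satisfying P of the non-backtracking walks that start with the edge p w and
  -- continue for fewer than n edges.
  branch : ℕ → Vertex G → Vertex G → List (Vertex G)
  branch zero    p w = []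
  branch (suc n) p w = filter P? (w ∷ []) ++ concatMap (branch n w) (children p w)

  ball : ℕ → Vertex G → List (Vertex G)
  ball k v = concatMap (branch k v) (neighbours G v)

  -- At least s of the tree δ n potential walks are absent or end outside P.
  Saves : ℕ → Vertex G → Vertex G → ℕ → Set
  Saves n p w s = length (branch n p w) + s ≤ tree δ n

  Saves-≤ : ∀ {n p w s t} → t ≤ s → Saves n p w s → Saves n p w t
  Saves-≤ {n} {p} {w} t≤s = ≤-trans (+-monoʳ-≤ (length (branch n p w)) t≤s)

  ∈-neighbours : ∀ {v w} → Adj v w → w ∈ neighbours G v
  ∈-neighbours {v} {w} = ∈-filter⁺ (adj? v) (∈-allFin w)

  ∈-neighbours⁻ : ∀ {v w} → w ∈ neighbours G v → Adj v w
  ∈-neighbours⁻ {v} {w} i = proj₂ (∈-filter⁻ (adj? v) {xs = allFin _} i)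

  ∈-children : ∀ {p w x} → Adj w x → x ≢ p → x ∈ children p w
  ∈-children {p} a x≢p = ∈-filter⁺ (λ x → ¬? (x ≟ p)) (∈-neighbours a) x≢p

  ∈-children⁻ : ∀ {p w x} → x ∈ children p w → Adj w x × x ≢ p
  ∈-children⁻ {p} {w} i with ∈-filter⁻ (λ x → ¬? (x ≟ p)) {xs = neighbours G w} i
  ... | j , x≢p = ∈-neighbours⁻ j , x≢p

  -- The predecessor `p` is one of at most `suc δ` neighbours, and the filter removes it.
  children-length : ∀ {p w} → Adj w p → length (children p w) ≤ δ
  children-length {p} {w} a = s≤s⁻¹ (≤-trans
    (filter-notAll (λ x → ¬? (x ≟ p)) (neighbours G w) (lose (∈-neighbours a) (λ p≢p → p≢p refl)))
    (degree≤ w))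

  private
    Below : ℕ → Vertex G → Vertex G → ℕ → Set
    Below n p w s = length (concatMap (branch n w) (children p w)) + s ≤ δ * tree δ n

    saves-any : ∀ {n p w s} → Below n p w s → Saves (suc n) p w s
    saves-any {n} {p} {w} {s} h = begin
      length (branch (suc n) p w) + s
        ≡⟨ cong (_+ s) (length-++ (filter P? (w ∷ []))) ⟩
      length (filter P? (w ∷ [])) + length (concatMap (branch n w) (children p w)) + s
        ≡⟨ +-assoc (length (filter P? (w ∷ []))) _ s ⟩
      length (filter P? (w ∷ [])) + (length (concatMap (branch n w) (children p w)) + s)
        ≤⟨ +-mono-≤ (length-filter P? (w ∷ [])) h ⟩
      tree δ (suc n) ∎
      where open ≤-Reasoning

    saves-free : ∀ {n p w s} → ¬ P w → Below n p w s → Saves (suc n) p w (suc s)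
    saves-free {n} {p} {w} {s} ¬Pw h with P? w
    ... | yes Pw = contradiction Pw ¬Pw
    ... | no _   = ≤-trans (≤-reflexive (+-suc _ s)) (s≤s h)

  saves-0 : ∀ n {p w} → Adj w p → Saves n p w 0
  saves-0 zero    a = z≤n
  saves-0 (suc n) {p} {w} a = saves-any {n} {p} {w} (≤-trans
    (concatMap-bound (branch n w) (tree δ n) λ i → saves-0 n (symm (proj₁ (∈-children⁻ i))))
    (*-monoˡ-≤ (tree δ n) (children-length a)))

  private
    nonneg : ∀ n {p w} → _Bounds_ (branch n w) (tree δ n) 0 (children p w)
    nonneg n i = saves-0 n (symm (proj₁ (∈-children⁻ i)))

  saves-leaf : ∀ {n p w} → Adj w p → ¬ P w → Saves (suc n) p w 1
  saves-leaf {n} {p} {w} a ¬Pw = saves-free {n} {p} {w} ¬Pw (≤-trans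
    (concatMap-bound (branch n w) (tree δ n) (nonneg n)) (*-monoˡ-≤ (tree δ n) (children-length a)))

  saves-step : ∀ {n p w x s} → Adj w p → ¬ P w → Adj w x → x ≢ p → Saves n w x s → Saves (suc n) p w (suc s)
  saves-step {n} {p} {w} a ¬Pw b x≢p h = saves-free {n} {p} {w} ¬Pw (≤-trans
    (concatMap-bound₁ (branch n w) (tree δ n) (nonneg n) (∈-children b x≢p) h) (*-monoˡ-≤ (tree δ n) (children-length a)))

  saves-fork : ∀ {n p w x y s t} → Adj w p → ¬ P w → x ≢ y →
               Adj w x → x ≢ p → Saves n w x s → Adj w y → y ≢ p → Saves n w y t → Saves (suc n) p w (suc (s + t))
  saves-fork {n} {p} {w} a ¬Pw x≢y b x≢p h c y≢p h′ = saves-free {n} {p} {w} ¬Pw (≤-trans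
    (concatMap-bound₂ (branch n w) (tree δ n) (nonneg n) x≢y (∈-children b x≢p) h (∈-children c y≢p) h′)
    (*-monoˡ-≤ (tree δ n) (children-length a)))

  -- Besides `s`, one unit comes from `w` and one from a second child, which is outside `P` or
  -- absent. The second slot exists because `2 ≤ δ`; this is where Δ ≥ 3 enters.
  saves-pendant : ∀ {n p w x s} → 2 ≤ δ → Adj w p → ¬ P w → (∀ y → Adj w y → ¬ P y) →
                  Adj w x → x ≢ p → Saves (suc n) w x s → Saves (suc (suc n)) p w (suc (suc s))
  saves-pendant {n} {p} {w} 2≤δ a ¬Pw free b x≢p h = saves-free {suc n} {p} {w} ¬Pw
    (concatMap-bound-pendant (branch (suc n) w) (tree δ (suc n))
      (λ {y} i → saves-leaf {n} (symm (proj₁ (∈-children⁻ i))) (free y (proj₁ (∈-children⁻ i))))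
      (∈-children b x≢p) h (s≤s z≤n) (children-length a) 2≤δ)

  ball-length : ∀ n v → length (ball n v) ≤ suc δ * tree δ n
  ball-length n v = subst (_≤ _) (+-identityʳ _) (≤-trans
    (concatMap-bound (branch n v) (tree δ n) λ i → saves-0 n (symm (∈-neighbours⁻ i)))
    (*-monoˡ-≤ (tree δ n) (degree≤ v)))

  ball-saves : ∀ n {v x s} → Adj v x → Saves n v x s → length (ball n v) + s ≤ suc δ * tree δ n
  ball-saves n {v} a h = ≤-trans
    (concatMap-bound₁ (branch n v) (tree δ n) (λ i → saves-0 n (symm (∈-neighbours⁻ i))) (∈-neighbours a) h)
    (*-monoˡ-≤ (tree δ n) (degree≤ v))

  ball-saves₂ : ∀ n {v x y s t} → x ≢ y → Adj v x → Saves n v x s → Adj v y → Saves n v y t →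
                length (ball n v) + (s + t) ≤ suc δ * tree δ n
  ball-saves₂ n {v} x≢y a h b h′ = ≤-trans
    (concatMap-bound₂ (branch n v) (tree δ n) (λ i → saves-0 n (symm (∈-neighbours⁻ i))) x≢y (∈-neighbours a) h (∈-neighbours b) h′)
    (*-monoˡ-≤ (tree δ n) (degree≤ v))

  -- A shortest walk does not backtrack: returning to `p` after two edges would leave a walk two
  -- edges shorter. Tails of shortest walks are again shortest, which drives the induction.
  ∈-branch : ∀ n {p w u m} → P u → Adj p w → Walk G w u m → m <ℕ n → (∀ l → Walk G p u l → suc m ≤ l) →
             u ∈ branch n p w
  ∈-branch (suc n) Pu a [] _ min = ∈-++⁺ˡ (∈-filter⁺ P? (here refl) Pu)
  ∈-branch (suc n) {p} {w} {u} Pu a (_∷_ {v = x} {n = m} b q) (s≤s m<n) min =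
    ∈-++⁺ʳ (filter P? (w ∷ [])) (∈-concatMap⁺ (branch n w) (lose (∈-children b x≢p)
      (∈-branch n Pu b q m<n λ l q′ → s≤s⁻¹ (min (suc l) (a ∷ q′)))))
    where
    x≢p : x ≢ p
    x≢p refl = 1+n≰n (≤-trans (n≤1+n _) (min m q))

  ∈-ball : ∀ {k v u} → P u → v ≢ u → Distance≤ G k v u → u ∈ ball k v
  ∈-ball Pu v≢u (_ , ([] , _) , _) = contradiction refl v≢u
  ∈-ball {k} {v} Pu v≢u (_ , (_∷_ {v = x} a q , min) , d≤k) =
    ∈-concatMap⁺ (branch k v) (lose (∈-neighbours a) (∈-branch k Pu a q d≤k min))

-- The geodesic seen from its middle.

record Arms (G : Graph) (D : Vertex G → ℕ) (k : ℕ) (a b : ℕ → Vertex G) : Set where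
  open Graph G using (Adj)
  field
    root   : a 0 ≡ b 0
    adjˡ   : ∀ {j} → suc j ≤ k → Adj (a j) (a (suc j))
    adjʳ   : ∀ {j} → suc j ≤ k → Adj (b j) (b (suc j))
    distˡ  : ∀ {j} → j ≤ k → D (a j) ≡ j
    distʳ  : ∀ {j} → j ≤ k → D (b j) ≡ j
    fork   : 1 ≤ k → a 1 ≢ b 1

  swap : Arms G D k b a
  swap = record
    { root = sym root ; adjˡ = adjʳ ; adjʳ = adjˡ ; distˡ = distʳ ; distʳ = distˡ ; fork = λ 1≤k → fork 1≤k ∘ sym }

  Off : Vertex G → Set
  Off u = ∀ {j} → j ≤ k → u ≢ a j × u ≢ b j

  separateˡ : ∀ {i j} → i ≤ k → j ≤ k → i ≢ j → a i ≢ a j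
  separateˡ i≤k j≤k i≢j eq = i≢j (trans (sym (distˡ i≤k)) (trans (cong D eq) (distˡ j≤k)))

  data Position (w : Vertex G) : Set where
    at-root  : w ≡ a 0 → Position w
    on-left  : ∀ j → suc j ≤ k → w ≡ a (suc j) → Position w
    on-right : ∀ j → suc j ≤ k → w ≡ b (suc j) → Position w
    off      : Off w → Position w

  -- Indices on the arms are levels, so `w` can only be `a (D w)` or `b (D w)`; two comparisons
  -- decide.
  position : ∀ w → Position w
  position w with D w in eq | D w ≤? k | a (D w) ≟ w | b (D w) ≟ w
  ... | zero  | _       | yes e | _     = at-root (sym e)
  ... | zero  | _       | _     | yes e = at-root (trans (sym e) (sym root))
  ... | suc j | yes j<k | yes e | _     = on-left j j<k (sym e)
  ... | suc j | yes j<k | _     | yes e = on-right j j<k (sym e)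
  ... | d     | no d≰k  | _     | _     = off λ j≤k →
    (λ { refl → d≰k (subst (_≤ k) (trans (sym (distˡ j≤k)) eq) j≤k) }) ,
    (λ { refl → d≰k (subst (_≤ k) (trans (sym (distʳ j≤k)) eq) j≤k) })
  ... | d     | _       | no ≢a | no ≢b = off λ j≤k →
    (λ { refl → ≢a (cong a (trans (sym eq) (distˡ j≤k))) }) ,
    (λ { refl → ≢b (cong b (trans (sym eq) (distʳ j≤k))) })

-- Savings along descending paths and along the geodesic.

module Savings
  (G : Graph) (δ : ℕ) (degree≤ : ∀ v → degree G v ≤ suc δ) (2≤δ : 2 ≤ δ)
  (D : Vertex G → ℕ)
  (D-adj : ∀ {u v} → Graph.Adj G u v → D v ≤ suc (D u))
  (D-down : ∀ {u c} → D u ≡ suc c → ∃ λ y → Graph.Adj G u y × D y ≡ c)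
  (D-zero : ∀ {u v} → D u ≡ 0 → D v ≡ 0 → u ≡ v)
  -- In the application `e` is the level of the vertex being coloured and `P` holds of the vertices
  -- coloured greedily before it.
  {P : Vertex G → Set} (P? : U.Decidable P) (e k : ℕ) (1≤k : 1 ≤ k)
  (near : ∀ {u} → D u <ℕ e → ¬ P u)
  where
  open Graph G using (Adj; symm)
  open Branches G δ degree≤ P?
  open Arms using (adjˡ; adjʳ; distˡ; distʳ; Off; separateˡ; fork; root; swap)

  FreeArm : (ℕ → Vertex G) → Set
  FreeArm a = ∀ {j} → 1 ≤ j → j ≤ k → ¬ P (a j)

  neighbours-free : ∀ {w} → suc (D w) <ℕ e → ∀ y → Adj w y → ¬ P y
  neighbours-free lt y adj = near (≤-trans (s≤s (D-adj adj)) lt)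

  -- The walk along the arm ends successively at `a j`, ..., `a (j + s - 1)`, each saving one;
  -- `j + s ≤ suc k` keeps them on the arm. The condition on `p` makes the outward move
  -- non-backtracking.
  outward : ∀ {a b} → Arms G D k a b → FreeArm a → ∀ s n j {p} → s ≤ n → 1 ≤ j → j + s ≤ suc k →
            Adj (a j) p → (suc j ≤ k → p ≢ a (suc j)) → Saves n p (a j) s
  outward A free zero n j _ _ _ adj _ = saves-0 n adj
  outward A free (suc zero) (suc n) j _ 1≤j le adj _ =
    saves-leaf {n} adj (free 1≤j (s≤s⁻¹ (subst (_≤ suc k) (+-comm j 1) le)))
  outward A free (suc (suc s)) (suc n) j (s≤s s≤n) 1≤j le adj p≢ =
    saves-step {n} {s = suc s} adj (free 1≤j (<⇒≤ j<k)) (adjˡ A j<k) (p≢ j<k ∘ sym)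
      (outward A free (suc s) n (suc j) s≤n (s≤s z≤n) le′ (symm (adjˡ A j<k))
        (λ lt → separateˡ A (<⇒≤ j<k) lt (<⇒≢ (n≤1+n (suc j)))))
    where
    le′ : suc j + suc s ≤ suc k
    le′ = subst (_≤ suc k) (+-suc j (suc s)) le
    j<k : suc j ≤ k
    j<k = ≤-trans (m≤m+n (suc j) s) (s≤s⁻¹ (subst (_≤ suc k) (+-suc (suc j) s) le′))

  module Side {a b : ℕ → Vertex G} (A : Arms G D k a b) (freeˡ : FreeArm a) (freeʳ : FreeArm b) where

    -- The next vertex of the geodesic b … root … a when it is traversed from a to b.
    inner : ℕ → Vertex G
    inner zero    = b 1
    inner (suc j) = a j

    inner-≢ : ∀ {j} → suc j ≤ k → a (suc j) ≢ inner j
    inner-≢ {zero}  lt = fork A lt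
    inner-≢ {suc j} lt = separateˡ A lt (≤-trans (n≤1+n j) (<⇒≤ lt)) (<⇒≢ (n≤1+n (suc j)) ∘ sym)

    root-adj : Adj (a 0) (b 1)
    root-adj = subst (λ r → Adj r (b 1)) (sym (root A)) (adjʳ A 1≤k)

    arm-near : ∀ {j} → j ≤ k → j <ℕ e → ¬ P (a j)
    arm-near j≤k lt = near (subst (_<ℕ e) (sym (distˡ A j≤k)) lt)

    arm-neighbours-free : ∀ {j} → j ≤ k → suc j <ℕ e → ∀ y → Adj (a j) y → ¬ P y
    arm-neighbours-free j≤k lt = neighbours-free (subst (λ d → suc d <ℕ e) (sym (distˡ A j≤k)) lt)

    root-outward : ∀ {n} → n ≤ k → Saves n (a 0) (b 1) n
    root-outward {n} n≤k = outward (swap A) freeʳ n n 1 ≤-refl (s≤s z≤n) (s≤s n≤k) (symm root-adj)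
      λ 2≤k → subst (_≢ b 2) (sym (root A)) (separateˡ (swap A) z≤n 2≤k λ ())

    -- The path towards the root and on into the other arm visits `suc n` vertices outside `P`. Each
    -- of `a j`, ..., `a 0` that is not the last vertex also saves one for an edge leaving the path,
    -- as its neighbours lie below level `e`: this gives `n ⊓ suc j` more.
    inward : ∀ n j {p} → n ≤ k → j ≤ k → suc j <ℕ e → Adj (a j) p → p ≢ inner j →
             Saves (suc n) p (a j) (suc n + n ⊓ suc j)
    inward zero j _ j≤k lt adj _ = saves-leaf {0} adj (arm-near j≤k (<⇒≤ lt))
    inward (suc m) zero {p} m<k j≤k lt adj p≢ =
      subst (Saves (suc (suc m)) p (a 0))
        (trans (cong (λ x → suc (suc (suc x))) (trans (sym (+-identityʳ m)) (cong (_+_ m) (sym (⊓-zeroʳ m)))))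
               (sym (cong suc (+-suc (suc m) (m ⊓ 0)))))
        (saves-pendant {m} 2≤δ adj (arm-near j≤k (<⇒≤ lt)) (arm-neighbours-free j≤k lt) root-adj (p≢ ∘ sym)
          (root-outward m<k))
    inward (suc m) (suc j) {p} m<k j<k lt adj p≢ =
      subst (Saves (suc (suc m)) p (a (suc j))) (sym (cong suc (+-suc (suc m) (m ⊓ suc j))))
        (saves-pendant {m} 2≤δ adj (arm-near j<k (<⇒≤ lt)) (arm-neighbours-free j<k lt) (symm (adjˡ A j<k)) (p≢ ∘ sym)
          (inward m j (<⇒≤ m<k) (<⇒≤ j<k) (<⇒≤ lt) (adjˡ A j<k) (inner-≢ j<k)))

    root-hit : ∀ {n p} → n ≤ k → 0 <ℕ e → Adj (a 0) p → Off A p → Saves (suc n) p (a 0) (suc (n + n))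
    root-hit {n} {p} n≤k lt adj p-off =
      saves-fork {n} adj (arm-near z≤n lt) (fork A 1≤k)
        (adjˡ A 1≤k) (proj₁ (p-off 1≤k) ∘ sym)
        (outward A freeˡ n n 1 ≤-refl (s≤s z≤n) (s≤s n≤k) (symm (adjˡ A 1≤k)) (λ 2≤k → separateˡ A z≤n 2≤k λ ()))
        root-adj (proj₂ (p-off 1≤k) ∘ sym) (root-outward n≤k)

    inward-far : ∀ {m j} → m ≤ k → suc j ≤ k → suc j <ℕ e → m ≤ suc j → Saves (suc m) (a (suc j)) (a j) (suc m + m)
    inward-far {m} {j} m≤k j<k lt m≤j = subst (λ x → Saves (suc m) (a (suc j)) (a j) (suc m + x)) (m≤n⇒m⊓n≡m m≤j)
      (inward m j m≤k (<⇒≤ j<k) lt (adjˡ A j<k) (inner-≢ j<k))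

    -- Inward, edges leaving the path contribute only `suc j` savings, since they stop at the root.
    -- The outward part of the same arm, from `a (suc (suc j))`, supplies the missing `m ∸ j`.
    hit-near : ∀ {m j p} → suc (suc m) ≤ k → suc j ≤ m → suc j <ℕ e → Adj (a (suc j)) p → Off A p →
               Saves (suc (suc m)) p (a (suc j)) (suc (suc m + suc m))
    hit-near {m} {j} {p} m<k j<m lt adj p-off =
      subst (Saves (suc (suc m)) p (a (suc j)))
        (cong suc (trans (+-assoc (suc m) (suc j) (m ∸ j)) (cong (λ x → suc m + suc x) (m+[n∸m]≡n (<⇒≤ j<m)))))
        (saves-fork {suc m} adj (arm-near j<k lt)
          (separateˡ A (<⇒≤ j<k) j+2≤k (<⇒≢ (n≤1+n (suc j))))
          (symm (adjˡ A j<k)) (proj₁ (p-off (<⇒≤ j<k)) ∘ sym)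
          (subst (λ x → Saves (suc m) (a (suc j)) (a j) (suc m + x)) (m≥n⇒m⊓n≡n j<m)
            (inward m j (<⇒≤ (<⇒≤ m<k)) (<⇒≤ j<k) lt (adjˡ A j<k) (inner-≢ j<k)))
          (adjˡ A j+2≤k) (proj₁ (p-off j+2≤k) ∘ sym)
          (outward A freeˡ (m ∸ j) (suc m) (suc (suc j)) (≤-trans (m∸n≤m m j) (n≤1+n m)) (s≤s z≤n)
            (subst (λ x → suc (suc x) ≤ suc k) (sym (m+[n∸m]≡n (<⇒≤ j<m))) (≤-trans m<k (n≤1+n k)))
            (symm (adjˡ A j+2≤k)) (λ le → separateˡ A j<k le (<⇒≢ (n≤1+n (suc (suc j)))))))
      where
      j+2≤k : suc (suc j) ≤ k
      j+2≤k = ≤-trans (s≤s j<m) (<⇒≤ m<k)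
      j<k : suc j ≤ k
      j<k = <⇒≤ j+2≤k

    -- When the walk is too short to pass the root, every vertex but the last gives an edge leaving
    -- the path, including `a (suc j)`, whose neighbours are below level `e` by hypothesis.
    -- Otherwise `hit-near` applies.
    hit : ∀ {m j p} → suc (suc m) ≤ k → suc j ≤ k → suc (suc j) <ℕ e → Adj (a (suc j)) p → Off A p →
          Saves (suc (suc m)) p (a (suc j)) (suc (suc m + suc m))
    hit {m} {j} {p} m<k j<k lt adj p-off with ≤-total m (suc j)
    ... | inj₂ j<m = hit-near m<k j<m (<⇒≤ lt) adj p-off
    ... | inj₁ m≤j = subst (Saves (suc (suc m)) p (a (suc j))) (cong suc (sym (+-suc (suc m) m)))
      (saves-pendant {m} 2≤δ adj (arm-near j<k (<⇒≤ lt)) (arm-neighbours-free j<k lt)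
        (symm (adjˡ A j<k)) (proj₁ (p-off (<⇒≤ j<k)) ∘ sym) (inward-far (<⇒≤ (<⇒≤ m<k)) j<k (<⇒≤ lt) m≤j))

    -- Here neighbours of `a (suc j)` may lie at level `e` and satisfy `P`, so no edge leaving the
    -- path is counted at this vertex: one saving less than in `hit`.
    first-hit : ∀ {m j p} → suc (suc m) ≤ k → suc j ≤ k → suc j <ℕ e → Adj (a (suc j)) p → Off A p →
                Saves (suc (suc m)) p (a (suc j)) (suc (suc m + m))
    first-hit {m} {j} {p} m<k j<k lt adj p-off with ≤-total m (suc j)
    ... | inj₂ j<m = Saves-≤ {suc (suc m)} {p} {a (suc j)} (s≤s (+-monoʳ-≤ (suc m) (n≤1+n m))) (hit-near m<k j<m lt adj p-off)
    ... | inj₁ m≤j = saves-step {suc m} adj (arm-near j<k lt)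
        (symm (adjˡ A j<k)) (proj₁ (p-off (<⇒≤ j<k)) ∘ sym) (inward-far (<⇒≤ (<⇒≤ m<k)) j<k lt m≤j)

  module Both {a b : ℕ → Vertex G} (A : Arms G D k a b) (freeˡ : FreeArm a) (freeʳ : FreeArm b) where
    module L = Side A freeˡ freeʳ
    module R = Side (swap A) freeʳ freeˡ
    open Arms A using (position; at-root; on-left; on-right; off)

    Off-swap : ∀ {u} → Off A u → Off (swap A) u
    Off-swap o j≤k = proj₂ (o j≤k) , proj₁ (o j≤k)

    off⇒D>0 : ∀ {w} → Off A w → ∃ λ c → D w ≡ suc c
    off⇒D>0 {w} w-off with D w in eq
    ... | suc c = c , refl
    ... | zero  = contradiction (D-zero eq (distˡ A z≤n)) (proj₁ (w-off z≤n))

    -- Descending towards the root saves `suc n` for the vertices of the path and `n` for edges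
    -- leaving it. Once the path meets the geodesic, `hit` or `root-hit` yields the same total.
    chain : ∀ n {w p} → suc n ≤ k → Off A p → Adj w p → D p ≡ suc (D w) → suc (D w) <ℕ e →
            Saves (suc n) p w (suc (n + n))
    chain zero _ _ adj _ lt = saves-leaf {0} adj (near (<⇒≤ lt))
    chain (suc m) {w} {p} m<k p-off adj Dp lt with position w
    ... | at-root refl = L.root-hit (<⇒≤ m<k) (≤-trans (s≤s z≤n) (<⇒≤ lt)) adj p-off
    ... | on-left j j<k refl = L.hit m<k j<k (subst (λ d → suc d <ℕ e) (distˡ A j<k) lt) adj p-off
    ... | on-right j j<k refl = R.hit m<k j<k (subst (λ d → suc d <ℕ e) (distʳ A j<k) lt) adj (Off-swap p-off)
    ... | off w-off with off⇒D>0 w-off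
    ...   | c , Dw with D-down Dw
    ...     | y , adj′ , Dy = subst (Saves (suc (suc m)) p w) (cong suc (sym (+-suc (suc m) m)))
      (saves-pendant {m} 2≤δ adj (near (<⇒≤ lt)) (neighbours-free lt) adj′ y≢p
        (chain m (<⇒≤ m<k) w-off (symm adj′) (trans Dw (cong suc (sym Dy))) lt′))
      where
      y≢p : y ≢ p
      -- The levels of `y` and `p` differ by two.
      y≢p refl = <⇒≢ (n≤1+n (suc c)) (trans (sym Dy) (trans Dp (cong suc Dw)))
      lt′ : suc (D y) <ℕ e
      lt′ = subst (λ d → suc d <ℕ e) (sym Dy) (<⇒≤ (subst (λ d → suc d <ℕ e) Dw lt))

    root-saves : length (ball k (a 0)) + (k + k) ≤ suc δ * tree δ k
    root-saves = ball-saves₂ k (fork A 1≤k) (adjˡ A 1≤k)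
      (outward A freeˡ k k 1 ≤-refl (s≤s z≤n) ≤-refl (symm (adjˡ A 1≤k)) (λ 2≤k → separateˡ A z≤n 2≤k λ ()))
      L.root-adj (L.root-outward ≤-refl)

    -- The saving is 2k - 2: all `k` vertices of a path descending from `v` or following the
    -- geodesic, and one more for each of these except the first and the last, or their replacements
    -- on the geodesic.
    off-saves : ∀ m → k ≡ suc (suc m) → ∀ {v} → Off A v → D v ≡ e → length (ball k v) + suc (suc m + m) ≤ suc δ * tree δ k
    off-saves m refl {v} v-off Dv with off⇒D>0 v-off
    ... | c , Dv′ with D-down Dv′
    ...   | y , adj , Dy = ball-saves k adj first
      where
      y<e : D y <ℕ e
      y<e = subst₂ (λ c′ e′ → c′ <ℕ e′) (sym Dy) (trans (sym Dv′) Dv) ≤-refl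
      first : Saves k v y (suc (suc m + m))
      first with position y
      ... | at-root refl = Saves-≤ {k} {v} {a 0} (s≤s (+-monoʳ-≤ (suc m) (n≤1+n m)))
                             (L.root-hit (n≤1+n (suc m)) (≤-trans (s≤s z≤n) y<e) (symm adj) v-off)
      ... | on-left j j<k refl = L.first-hit ≤-refl j<k (subst (_<ℕ e) (distˡ A j<k) y<e) (symm adj) v-off
      ... | on-right j j<k refl = R.first-hit ≤-refl j<k (subst (_<ℕ e) (distʳ A j<k) y<e) (symm adj) (Off-swap v-off)
      ... | off y-off with off⇒D>0 y-off
      ...   | c′ , Dy′ with D-down Dy′
      -- Neighbours of `y` may lie at level `e`, so only `y` itself is counted here.
      ...     | z , adj′ , Dz = saves-step {suc m} (symm adj) (near y<e) adj′ z≢v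
        (chain m (n≤1+n (suc m)) y-off (symm adj′) (trans Dy′ (cong suc (sym Dz))) (subst (λ d → d <ℕ e) (trans Dy′ (cong suc (sym Dz))) y<e))
        where
        z≢v : z ≢ v
        z≢v refl = <⇒≢ (≤-trans (subst (_≤ D y) (cong suc (sym Dz)) (≤-reflexive (sym Dy′))) (<⇒≤ y<e)) Dv

-- Distances, walks and geodesics.

module Distance (G : Graph) (conn : Connected G) where
  open Graph G using (Adj; symm)

  dist : Vertex G → Vertex G → ℕ
  dist u v = proj₁ (least (walk? G u v) _ (proj₂ (conn u v)))

  dist-walk : ∀ u v → Walk G u v (dist u v)
  dist-walk u v = proj₁ (proj₂ (least (walk? G u v) _ (proj₂ (conn u v))))

  dist-min : ∀ {u v n} → Walk G u v n → dist u v ≤ n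
  dist-min {u} {v} {n} = proj₂ (proj₂ (least (walk? G u v) _ (proj₂ (conn u v)))) n

  dist-adj : ∀ {r u v} → Adj u v → dist v r ≤ suc (dist u r)
  dist-adj {r} {u} a = dist-min (symm a ∷ dist-walk u r)

  dist-down : ∀ {r u c} → dist u r ≡ suc c → ∃ λ y → Adj u y × dist y r ≡ c
  dist-down {r} {u} {c} eq with dist u r | dist-walk u r | (λ {n} → dist-min {u} {r} {n})
  dist-down refl | .(suc _) | _∷_ {v = y} a q | min =
    y , a , ≤-antisym (dist-min q) (s≤s⁻¹ (min (a ∷ dist-walk y _)))

  dist-zero : ∀ {r u v} → dist u r ≡ 0 → dist v r ≡ 0 → u ≡ v
  dist-zero {r} {u} {v} eq eq′ = trans (endpoint (subst (Walk G u r) eq (dist-walk u r)))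
                                       (sym (endpoint (subst (Walk G v r) eq′ (dist-walk v r))))
    where
    endpoint : ∀ {x} → Walk G x r 0 → x ≡ r
    endpoint [] = refl

module Walks (G : Graph) where
  open Graph G using (Adj; symm)

  infixr 5 _++ʷ_
  _++ʷ_ : ∀ {u v w m n} → Walk G u v m → Walk G v w n → Walk G u w (m + n)
  []      ++ʷ q = q
  (a ∷ p) ++ʷ q = a ∷ (p ++ʷ q)

  -- Constantly the last vertex beyond the end of the walk.
  vertexAt : ∀ {u v n} → Walk G u v n → ℕ → Vertex G
  vertexAt ([] {u})      _       = u
  vertexAt (_∷_ {u} a p) zero    = u
  vertexAt (a ∷ p)       (suc i) = vertexAt p i

  vertexAt-0 : ∀ {u v n} (p : Walk G u v n) → vertexAt p 0 ≡ u
  vertexAt-0 []      = refl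
  vertexAt-0 (a ∷ p) = refl

  vertexAt-adj : ∀ {u v n} (p : Walk G u v n) {i} → suc i ≤ n → Adj (vertexAt p i) (vertexAt p (suc i))
  vertexAt-adj (_∷_ {u} a p) {zero}  _        = subst (Adj u) (sym (vertexAt-0 p)) a
  vertexAt-adj (a ∷ p)       {suc i} (s≤s le) = vertexAt-adj p le

  prefix : ∀ {u v n} (p : Walk G u v n) {i} → i ≤ n → Walk G u (vertexAt p i) i
  prefix {u} p {zero} _ = subst (λ x → Walk G u x 0) (sym (vertexAt-0 p)) []
  prefix (a ∷ p) {suc i} (s≤s le) = a ∷ prefix p le

  suffix : ∀ {u v n} (p : Walk G u v n) {i} → i ≤ n → Walk G (vertexAt p i) v (n ∸ i)
  suffix {v = v} {n} p {zero} _ = subst (λ x → Walk G x v n) (sym (vertexAt-0 p)) p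
  suffix (a ∷ p) {suc i} (s≤s le) = suffix p le

  segment : ∀ {u v n} (p : Walk G u v n) i j → i + j ≤ n → Walk G (vertexAt p i) (vertexAt p (i + j)) j
  segment p i zero le = subst (λ x → Walk G (vertexAt p i) (vertexAt p x) 0) (sym (+-identityʳ i)) []
  segment {n = n} p i (suc j) le = subst (λ x → Walk G (vertexAt p i) (vertexAt p x) (suc j)) (sym (+-suc i j))
    (vertexAt-adj p (≤-trans (m≤m+n (suc i) j) le′) ∷ segment p (suc i) j le′)
    where
    le′ : suc i + j ≤ n
    le′ = subst (_≤ n) (+-suc i j) le

  -- Splicing `q` between the prefix up to `i` and the suffix from `j` gives a walk from `u` to `v`,
  -- hence of length at least `n`.
  geodesic-≤ : ∀ {u v n} (p : Walk G u v n) → (∀ m → Walk G u v m → n ≤ m) →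
               ∀ {i j m} → i ≤ n → j ≤ n → Walk G (vertexAt p i) (vertexAt p j) m → j ≤ i + m
  geodesic-≤ {n = n} p min {i} {j} {m} i≤n j≤n q = +-cancelʳ-≤ (n ∸ j) j (i + m) (begin
    j + (n ∸ j)       ≡⟨ m+[n∸m]≡n j≤n ⟩
    n                 ≤⟨ min _ ((prefix p i≤n ++ʷ q) ++ʷ suffix p j≤n) ⟩
    i + m + (n ∸ j)   ∎)
    where open ≤-Reasoning

module GeodesicArms (G : Graph) (conn : Connected G) (k : ℕ) (u v : Vertex G)
                    (far : k + k ≤ Distance.dist G conn u v) where
  open Graph G using (Adj; symm)
  open Distance G conn
  open Walks G

  private
    p = dist-walk u v
    s = vertexAt p

    lower : ∀ {i j m} → i ≤ k + k → j ≤ k + k → Walk G (s i) (s j) m → j ≤ i + m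
    lower i≤ j≤ = geodesic-≤ p (λ _ → dist-min) (≤-trans i≤ far) (≤-trans j≤ far)

    k≤ : k ≤ k + k
    k≤ = m≤m+n k k

  -- The middle of the first 2k edges; the geodesic from `u` to `v` may be longer.
  centre : Vertex G
  centre = s k

  left right : ℕ → Vertex G
  left  j = s (k + j)
  right j = s (k ∸ j)

  -- Positions `k ∸ j` and `k + i` on a geodesic are `i + j` apart. With `i + j` equal to `k + 1`
  -- this allows a shared colour.
  apart : ∀ {i j m} → i ≤ k → j ≤ k → Walk G (left i) (right j) m → i + j ≤ m
  apart {i} {j} {m} i≤k j≤k q = +-cancelˡ-≤ k (i + j) m (begin
    k + (i + j)         ≡⟨ sym (+-assoc k i j) ⟩
    k + i + j           ≤⟨ +-monoˡ-≤ j (lower (≤-trans (m∸n≤m k j) k≤) (+-monoʳ-≤ k i≤k) (walk-reverse G q)) ⟩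
    k ∸ j + m + j       ≡⟨ +-*-Solver.solve 3 (λ a b c → a :+ b :+ c := (a :+ c) :+ b) refl (k ∸ j) m j ⟩
    k ∸ j + j + m       ≡⟨ cong (_+ m) (m∸n+n≡m j≤k) ⟩
    k + m               ∎)
    where open ≤-Reasoning
          open +-*-Solver using (_:+_; _:=_)

  left-dist : ∀ {j} → j ≤ k → dist (left j) centre ≡ j
  left-dist {j} j≤k = ≤-antisym
    (dist-min (walk-reverse G (segment p k j (≤-trans (+-monoʳ-≤ k j≤k) far))))
    (+-cancelˡ-≤ k _ _ (lower k≤ (+-monoʳ-≤ k j≤k) (walk-reverse G (dist-walk (left j) centre))))

  right-dist : ∀ {j} → j ≤ k → dist (right j) centre ≡ j
  right-dist {j} j≤k = ≤-antisym
    (dist-min (subst (λ x → Walk G (right j) (s x) j) (m∸n+n≡m j≤k)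
      (segment p (k ∸ j) j (subst (_≤ dist u v) (sym (m∸n+n≡m j≤k)) (≤-trans k≤ far)))))
    (+-cancelˡ-≤ (k ∸ j) _ _ (subst (_≤ k ∸ j + dist (right j) centre) (sym (m∸n+n≡m j≤k))
      (lower (≤-trans (m∸n≤m k j) k≤) k≤ (dist-walk (right j) centre))))

  arms : Arms G (λ x → dist x centre) k left right
  arms = record
    { root  = cong s (+-identityʳ k)
    ; adjˡ  = λ {j} j<k → subst (λ x → Adj (left j) (s x)) (sym (+-suc k j))
                (vertexAt-adj p (≤-trans (subst (_≤ k + k) (+-suc k j) (+-monoʳ-≤ k j<k)) far))
    ; adjʳ  = λ {j} j<k → symm (subst (λ x → Adj (right (suc j)) (s x)) (sym (∸-suc′ j<k))
                (vertexAt-adj p (≤-trans (subst (_≤ k) (∸-suc′ j<k) (m∸n≤m k j)) (≤-trans k≤ far))))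
    ; distˡ = left-dist
    ; distʳ = right-dist
    ; fork  = λ 1≤k eq → contradiction (apart 1≤k 1≤k (subst (λ x → Walk G (left 1) x 0) eq [])) λ ()
    }
    where
    ∸-suc′ : ∀ {j} → suc j ≤ k → k ∸ j ≡ suc (k ∸ suc j)
    ∸-suc′ {j} j<k = +-∸-assoc 1 j<k

-- Greedy colouring with preassigned colours.

missing-element : ∀ {n} (xs : List (Fin n)) → length xs <ℕ n → ∃ λ i → i ∉ xs
missing-element xs lt = ¬∀⟶∃¬ _ (_∈ xs) (λ i → _∈?_ _≟_ i xs) λ all → <⇒≱ lt (exhaustive⇒≤length all)

module Greedy (H : Graph) {c : ℕ} (rank : Vertex H → ℕ) (rank-injective : ∀ {u v} → rank u ≡ rank v → u ≡ v)
  {T : Vertex H → Set} (T? : U.Decidable T) (preset : Vertex H → Fin c)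
  (preset-proper : ∀ u v → T u → T v → Graph.Adj H u v → preset u ≢ preset v)
  (available : ∀ v → ¬ T v → (col : Vertex H → Fin c) → (∀ u → T u → col u ≡ preset u) →
               ∃ λ x → ∀ u → Graph.Adj H v u → T u ⊎ rank v <ℕ rank u → col u ≢ x)
  where
  open Graph H using (Adj; symm)

  Coloured : ℕ → Vertex H → Set
  Coloured m u = T u ⊎ m ≤ rank u

  -- A partial colouring is kept as a total map; its values outside `Coloured m` are arbitrary.
  Partial : ℕ → Set
  Partial m = ∃ λ (col : Vertex H → Fin c) → (∀ u → T u → col u ≡ preset u) ×
    (∀ u v → Coloured m u → Coloured m v → Adj u v → col u ≢ col v)

  recolour : Vertex H → Fin c → (Vertex H → Fin c) → Vertex H → Fin c
  recolour v x col u with u ≟ v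
  ... | yes _ = x
  ... | no _  = col u

  -- Ranks are injective, so at most one vertex becomes newly coloured, and only that one is
  -- recoloured.
  extend : ∀ m → Partial (suc m) → Partial m
  extend m (col , agrees , proper) with any? (λ v → (rank v ℕ.≟ m) ×-dec ¬? (T? v))
  ... | no none = col , agrees , λ u v cu cv → proper u v (earlier cu) (earlier cv)
    where
    earlier : ∀ {u} → Coloured m u → Coloured (suc m) u
    earlier (inj₁ t) = inj₁ t
    earlier {u} (inj₂ le) with m≤n⇒m<n∨m≡n le
    ... | inj₁ lt = inj₂ lt
    ... | inj₂ eq = inj₁ (decidable-stable (T? u) λ ¬t → none (u , sym eq , ¬t))
  ... | yes (v , rv , ¬t) with available v ¬t col agrees
  ...   | x , avoids = recolour v x col , agrees′ , proper′
    where
    agrees′ : ∀ u → T u → recolour v x col u ≡ preset u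
    agrees′ u t with u ≟ v
    ... | yes refl = contradiction t ¬t
    ... | no _     = agrees u t
    earlier : ∀ {u} → u ≢ v → Coloured m u → Coloured (suc m) u
    earlier u≢v (inj₁ t) = inj₁ t
    earlier {u} u≢v (inj₂ le) with m≤n⇒m<n∨m≡n le
    ... | inj₁ lt = inj₂ lt
    ... | inj₂ eq = contradiction (rank-injective (trans (sym eq) (sym rv))) u≢v
    later : ∀ {u} → Coloured (suc m) u → T u ⊎ rank v <ℕ rank u
    later (inj₁ t)  = inj₁ t
    later (inj₂ lt) = inj₂ (subst (λ n → suc n ≤ _) (sym rv) lt)
    proper′ : ∀ u w → Coloured m u → Coloured m w → Adj u w → recolour v x col u ≢ recolour v x col w
    proper′ u w cu cw a with u ≟ v | w ≟ v
    ... | yes refl | yes refl = contradiction a (Graph.irrefl H u)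
    ... | yes refl | no w≢v   = avoids w a (later (earlier w≢v cw)) ∘ sym
    ... | no u≢v   | yes refl = avoids u (symm a) (later (earlier u≢v cu))
    ... | no u≢v   | no w≢v   = proper u w (earlier u≢v cu) (earlier w≢v cw) a

  colourable : ∀ m → (∀ u → rank u <ℕ m) → Colourable H c
  -- Above all ranks only `T` counts as coloured, so `preset` itself is the starting colouring.
  colourable m bound = descend m (preset , (λ _ _ → refl) , λ u v cu cv → preset-proper u v (early cu) (early cv))
    where
    early : ∀ {u} → Coloured m u → T u
    early (inj₁ t)  = t
    early {u} (inj₂ le) = contradiction le (<⇒≱ (bound u))
    descend : ∀ n → Partial n → Colourable H c
    descend zero    (col , _ , proper) = col , λ u v → proper u v (inj₂ z≤n) (inj₂ z≤n)
    descend (suc n) partial            = descend n (extend n partial)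

-- Colouring the power of a graph containing a geodesic of length 2k.

clip : ∀ n → ℕ → Fin (suc n)
clip n i = fromℕ< (s≤s (m⊓n≤m n i))

clip-injective : ∀ {n i j} → i ≤ n → j ≤ n → clip n i ≡ clip n j → i ≡ j
clip-injective {n} {i} {j} i≤n j≤n eq = trans (sym (value i≤n)) (trans (cong toℕ eq) (value j≤n))
  where
  value : ∀ {m} → m ≤ n → toℕ (clip n m) ≡ m
  value m≤n = trans (toℕ-fromℕ< _) (m≥n⇒m⊓n≡n m≤n)

n≤tree : ∀ {δ} → 1 ≤ δ → ∀ n → n ≤ tree δ n
n≤tree 1≤δ zero = z≤n
n≤tree {suc δ} 1≤δ (suc n) = s≤s (≤-trans (n≤tree 1≤δ n) (m≤m+n _ _))

module LargeDiameter (G : Graph) (conn : Connected G) (δ : ℕ) (degree≤ : ∀ v → degree G v ≤ suc δ) (2≤δ : 2 ≤ δ)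
  (k : ℕ) (1≤k : 1 ≤ k) (u₀ v₀ : Vertex G) (far : k + k ≤ Distance.dist G conn u₀ v₀)
  -- The number of colours `suc c` is f(k,Δ) + 3 - k, stated without subtraction.
  (c : ℕ) (c-def : suc c + k ≡ suc δ * tree δ k + 3) where
  open Graph G using (Adj; order)
  open Distance G conn
  open GeodesicArms G conn k u₀ v₀ far
  open Arms arms using (Position; position; at-root; on-left; on-right; off)

  D : Vertex G → ℕ
  D u = dist u centre

  -- As f(k,Δ) is at least twice `tree δ k`, hence at least 2k, the labels below `k` fit among the
  -- colours and `clip` separates them.
  k≤c : k ≤ c
  k≤c = s≤s⁻¹ (+-cancelʳ-≤ k (suc k) (suc c) (begin
    suc k + k                       ≤⟨ s≤s (+-mono-≤ (n≤tree 1≤δ k) (n≤tree 1≤δ k)) ⟩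
    suc (tree δ k + tree δ k)       ≤⟨ s≤s (+-monoʳ-≤ (tree δ k) (m≤n*m (tree δ k) δ ⦃ ℕ.>-nonZero 1≤δ ⦄)) ⟩
    1 + (tree δ k + δ * tree δ k)   ≤⟨ +-monoˡ-≤ (suc δ * tree δ k) {1} {3} (s≤s z≤n) ⟩
    3 + suc δ * tree δ k            ≡⟨ +-comm 3 _ ⟩
    suc δ * tree δ k + 3            ≡⟨ sym c-def ⟩
    suc c + k                       ∎))
    where open ≤-Reasoning
          1≤δ = <⇒≤ 2≤δ

  OnArm : ∀ {u} → Position u → Set
  OnArm (on-left _ _ _)  = ⊤
  OnArm (on-right _ _ _) = ⊤
  OnArm _                = ⊥

  T : Vertex G → Set
  T u = OnArm (position u)

  T? : U.Decidable T
  T? u with position u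
  ... | at-root _      = no λ ()
  ... | on-left _ _ _  = yes _
  ... | on-right _ _ _ = yes _
  ... | off _          = no λ ()

  -- left (i + 1) and right (k - i) are at distance k + 1 and receive the same label.
  label : ∀ {u} → Position u → ℕ
  label (on-left j _ _)  = j
  label (on-right j _ _) = k ∸ suc j
  label _                = 0

  label<k : ∀ {u} (q : Position u) → label q <ℕ k
  label<k (at-root _)         = 1≤k
  label<k (on-left j j<k _)   = j<k
  label<k (on-right j j<k _)  = m∸1+n<m k j j<k
    where
    m∸1+n<m : ∀ m n → n <ℕ m → m ∸ suc n <ℕ m
    m∸1+n<m (suc m) n _ = s≤s (m∸n≤m m n)
  label<k (off _)             = 1≤k

  preset : Vertex G → Fin (suc c)
  preset u = clip c (label (position u))

  -- On one arm equal labels mean equal vertices. On opposite arms they mean indices with sum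
  -- `k + 1`, and `apart` contradicts a distance of at most `k`.
  label-apart : ∀ {u v} (q : Position u) (q′ : Position v) → OnArm q → OnArm q′ →
                u ≢ v → Distance≤ G k u v → label q ≢ label q′
  label-apart (on-left i _ refl) (on-left j _ refl) _ _ u≢v _ eq = u≢v (cong (left ∘ suc) eq)
  label-apart (on-right i i<k refl) (on-right j j<k refl) _ _ u≢v _ eq = u≢v (cong right (∸-cancelˡ-≡ i<k j<k eq))
  label-apart (on-left i i<k refl) (on-right j j<k refl) _ _ _ (d , (w , _) , d≤k) refl =
    1+n≰n (≤-trans (subst (_≤ d) (cong suc (m∸n+n≡m j<k)) (apart i<k j<k w)) d≤k)
  label-apart (on-right i i<k refl) (on-left j j<k refl) _ _ _ (d , (w , _) , d≤k) refl =
    1+n≰n (≤-trans (subst (_≤ d) (cong suc (m∸n+n≡m i<k)) (apart j<k i<k (walk-reverse G w))) d≤k)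

  -- The lexicographic order by level and then by vertex number, in one natural number.
  rank : Vertex G → ℕ
  rank u = D u * order + toℕ u

  rank-mono : ∀ {u v} → D u <ℕ D v → rank u <ℕ rank v
  rank-mono {u} {v} lt = begin
    suc (D u * order + toℕ u)    ≡⟨ sym (+-suc (D u * order) (toℕ u)) ⟩
    D u * order + suc (toℕ u)    ≤⟨ +-monoʳ-≤ (D u * order) (toℕ<n u) ⟩
    D u * order + order          ≡⟨ +-comm (D u * order) order ⟩
    suc (D u) * order            ≤⟨ *-monoˡ-≤ order lt ⟩
    D v * order                  ≤⟨ m≤m+n (D v * order) (toℕ v) ⟩
    rank v                       ∎
    where open ≤-Reasoning

  rank-injective : ∀ {u v} → rank u ≡ rank v → u ≡ v
  rank-injective {u} {v} eq with <-cmp (D u) (D v)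
  ... | tri< lt _ _ = contradiction eq (<⇒≢ (rank-mono lt))
  ... | tri> _ _ gt = contradiction (sym eq) (<⇒≢ (rank-mono gt))
  ... | tri≈ _ D≡ _ = toℕ-injective (+-cancelˡ-≡ (D u * order) _ _
                        (trans eq (cong (λ d → d * order + toℕ v) (sym D≡))))

  left∈T : ∀ {j} → 1 ≤ j → j ≤ k → T (left j)
  left∈T {suc j} _ j<k with position (left (suc j))
  ... | at-root eq     = Arms.separateˡ arms j<k z≤n (λ ()) eq
  ... | on-left _ _ _  = _
  ... | on-right _ _ _ = _
  ... | off o          = proj₁ (o j<k) refl

  right∈T : ∀ {j} → 1 ≤ j → j ≤ k → T (right j)
  right∈T {suc j} _ j<k with position (right (suc j))
  ... | at-root eq     = Arms.separateˡ (Arms.swap arms) j<k z≤n (λ ()) (trans eq (Arms.root arms))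
  ... | on-left _ _ _  = _
  ... | on-right _ _ _ = _
  ... | off o          = proj₂ (o j<k) refl

  module _ (v : Vertex G) (v∉T : ¬ T v) where

    -- The vertices coloured greedily before `v`. Preassigned vertices are left out because
    -- `available` forbids all `k` of their colours at once.
    Blocking : Vertex G → Set
    Blocking u = ¬ T u × rank v <ℕ rank u

    blocking? : U.Decidable Blocking
    blocking? u = ¬? (T? u) ×-dec (rank v <ℕ? rank u)

    open Branches G δ degree≤ blocking?
    -- The threshold is `D v`: vertices strictly closer to the centre have smaller rank, while
    -- vertices at the level of `v` may block.
    open Savings G δ degree≤ 2≤δ D dist-adj dist-down dist-zero blocking? (D v) k 1≤k
      (λ lt (_ , gt) → <-asym (rank-mono lt) gt)
    open Both arms (λ 1≤j j≤k (∉T , _) → ∉T (left∈T 1≤j j≤k)) (λ 1≤j j≤k (∉T , _) → ∉T (right∈T 1≤j j≤k))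

    few-blocking-at : (q : Position v) → ¬ OnArm q → length (ball k v) + (k + k) ≤ suc δ * tree δ k + 2
    few-blocking-at (on-left _ _ _)  v∉ = contradiction tt v∉
    few-blocking-at (on-right _ _ _) v∉ = contradiction tt v∉
    few-blocking-at (at-root refl)   _  = ≤-trans root-saves (m≤m+n _ 2)
    few-blocking-at (off v-off)      _  = go k refl
      where
      go : ∀ n → k ≡ n → length (ball k v) + (k + k) ≤ suc δ * tree δ k + 2
      go zero          refl = contradiction 1≤k λ ()
      -- For `k` = 1 the claimed saving 2k - 2 is 0, and the size of the ball suffices.
      go (suc zero)    refl = +-monoˡ-≤ 2 (ball-length k v)
      go (suc (suc m)) eq   = begin
        length (ball k v) + (k + k)                       ≡⟨ cong (λ x → length (ball k v) + x) (trans (cong (λ x → x + x) eq) (double m)) ⟩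
        length (ball k v) + (suc (suc m + m) + 2)         ≡⟨ sym (+-assoc (length (ball k v)) _ 2) ⟩
        length (ball k v) + suc (suc m + m) + 2           ≤⟨ +-monoˡ-≤ 2 (off-saves m eq v-off refl) ⟩
        suc δ * tree δ k + 2                              ∎
        where
        open ≤-Reasoning
        double : ∀ m → suc (suc m) + suc (suc m) ≡ suc (suc m + m) + 2
        double = +-*-Solver.solve 1 (λ m → (con 2 :+ m) :+ (con 2 :+ m) := (con 2 :+ m :+ m) :+ con 2) refl
          where open +-*-Solver using (con; _:+_; _:=_)

    -- At most k + f(k,Δ) - (2k - 2) = f(k,Δ) + 2 - k colours are forbidden, one fewer than there
    -- are.
    available : (col : Vertex G → Fin (suc c)) → (∀ u → T u → col u ≡ preset u) →
                ∃ λ x → ∀ u → Graph.Adj (power k G) v u → T u ⊎ rank v <ℕ rank u → col u ≢ x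
    available col agrees with missing-element forbidden short
      where
      forbidden : List (Fin (suc c))
      forbidden = map (clip c) (upTo k) ++ map col (ball k v)
      length-forbidden : length forbidden ≡ k + length (ball k v)
      length-forbidden = trans (length-++ (map (clip c) (upTo k)))
        (cong₂ _+_ (trans (length-map (clip c) (upTo k)) (length-upTo k)) (length-map col (ball k v)))
      short : length forbidden <ℕ suc c
      short = +-cancelʳ-≤ k _ _ (begin
        suc (length forbidden) + k                ≡⟨ cong (λ x → suc x + k) length-forbidden ⟩
        suc (k + length (ball k v)) + k           ≡⟨ cong suc (trans (cong (_+ k) (+-comm k _)) (+-assoc (length (ball k v)) k k)) ⟩
        suc (length (ball k v) + (k + k))         ≤⟨ s≤s (few-blocking-at (position v) v∉T) ⟩
        suc (suc δ * tree δ k + 2)                ≡⟨ sym (+-suc (suc δ * tree δ k) 2) ⟩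
        suc δ * tree δ k + 3                      ≡⟨ sym c-def ⟩
        suc c + k                                 ∎)
        where open ≤-Reasoning
    ... | x , x∉ = x , λ { u (v≢u , near) status refl → x∉ (is-forbidden u v≢u near status) }
      where
      is-forbidden : ∀ u → v ≢ u → Distance≤ G k v u → T u ⊎ rank v <ℕ rank u →
                     col u ∈ map (clip c) (upTo k) ++ map col (ball k v)
      is-forbidden u v≢u near status with T? u | status
      ... | yes t | _       = ∈-++⁺ˡ (subst (_∈ map (clip c) (upTo k)) (sym (agrees u t))
                                (∈-map⁺ (clip c) (∈-upTo⁺ (label<k (position u)))))
      ... | no ∉T | inj₁ t  = contradiction t ∉T
      ... | no ∉T | inj₂ lt = ∈-++⁺ʳ (map (clip c) (upTo k)) (∈-map⁺ col (∈-ball (∉T , lt) v≢u near))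

  power-colourable : Colourable (power k G) (suc c)
  power-colourable = Greedy.colourable (power k G) rank rank-injective T? preset
    (λ { u v t t′ (u≢v , near) eq → label-apart (position u) (position v) t t′ u≢v near
         (clip-injective (≤-trans (<⇒≤ (label<k (position u))) k≤c) (≤-trans (<⇒≤ (label<k (position v))) k≤c) eq) })
    available (suc (M * order + order)) bound
    where
    M : ℕ
    M = max 0 (map D (allFin order))
    bound : ∀ u → rank u <ℕ suc (M * order + order)
    bound u = s≤s (+-mono-≤ (*-monoˡ-≤ order (All.lookup (xs≤max 0 (map D (allFin order))) (∈-map⁺ D (∈-allFin u)))) (<⇒≤ (toℕ<n u)))

-- Finitely many graphs of bounded order.

Matrices : ℕ → ℕ
Matrices n = (2 ^ n) ^ n

module _ {n : ℕ} where

  entry : Fin (Matrices n) → Fin n → Fin n → Fin 2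
  entry m u v = finToFun {2} {n} (finToFun {2 ^ n} {n} m u) v

  -- Symmetrising the matrix and ignoring its diagonal turns every code into a graph, so codes need
  -- no validity condition.
  graphOf : Fin (Matrices n) → Graph
  graphOf m = record
    { order  = n
    ; Adj    = λ u v → u ≢ v × (entry m u v ≡ suc zero ⊎ entry m v u ≡ suc zero)
    ; adj?   = λ u v → ¬? (u ≟ v) ×-dec ((entry m u v ≟ suc zero) ⊎-dec (entry m v u ≟ suc zero))
    ; symm   = λ { (u≢v , inj₁ e) → u≢v ∘ sym , inj₂ e ; (u≢v , inj₂ e) → u≢v ∘ sym , inj₁ e }
    ; irrefl = λ { v (v≢v , _) → v≢v refl }
    }

module _ (G : Graph) where
  open Graph G hiding (Vertex)

  bit : Vertex G → Vertex G → Fin 2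
  bit u v with adj? u v
  ... | yes _ = suc zero
  ... | no _  = zero

  bit⁺ : ∀ {u v} → Adj u v → bit u v ≡ suc zero
  bit⁺ {u} {v} a with adj? u v
  ... | yes _ = refl
  ... | no ¬a = contradiction a ¬a

  bit⁻ : ∀ {u v} → bit u v ≡ suc zero → Adj u v
  bit⁻ {u} {v} eq with adj? u v
  ... | yes a = a

  code : Fin (Matrices order)
  code = funToFin λ u → funToFin (bit u)

  entry-code : ∀ u v → entry code u v ≡ bit u v
  entry-code u v = trans (cong (λ row → finToFun {2} {order} row v) (finToFun-funToFin (λ u → funToFin (bit u)) u))
                         (finToFun-funToFin (bit u) v)

  ≅-graphOf : G ≅ graphOf code
  ≅-graphOf = record
    { bijection = ↔-id _
    ; preserves = λ u v → mk⇔
        (λ a → (λ { refl → irrefl u a }) , inj₁ (trans (entry-code u v) (bit⁺ a)))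
        (λ { (_ , inj₁ e) → bit⁻ (trans (sym (entry-code u v)) e)
           ; (_ , inj₂ e) → symm (bit⁻ (trans (sym (entry-code v u)) e)) })
    }

-- The list runs over all matrices of size at most `M`, whether or not their graphs satisfy `P`;
-- covering is all that is asked.
boundedOrder-finite : ∀ {ℓ} (M : ℕ) (P : Graph → Set ℓ) → (∀ G → P G → Graph.order G ≤ M) → FinitelyManyUpToIso P
boundedOrder-finite M P bound = concatMap (λ n → map (graphOf {n}) (allFin (Matrices n))) (upTo (suc M)) ,
  λ G PG → Any.map (λ { refl → ≅-graphOf G }) (∈-concatMap⁺ (λ n → map (graphOf {n}) (allFin (Matrices n)))
    (lose (∈-upTo⁺ (s≤s (bound G PG))) (∈-map⁺ graphOf (∈-allFin (code G)))))

-- Small diameter forces small order.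

inhabited-≤ : ∀ {n M} → (Fin n → n ≤ M) → n ≤ M
inhabited-≤ {zero}  h = z≤n
inhabited-≤ {suc n} h = h zero

-- With `P` trivially true, the ball of radius `d` about a vertex reaches every other vertex.
-- `inhabited-≤` supplies the centre and settles the graph without vertices.
smallDiameter-order : (G : Graph) (conn : Connected G) (δ : ℕ) → (∀ v → degree G v ≤ suc δ) → ∀ d →
  (∀ u v → Distance.dist G conn u v ≤ d) → Graph.order G ≤ suc (suc δ * tree δ d)
smallDiameter-order G conn δ degree≤ d small = inhabited-≤ λ v → ≤-trans (exhaustive⇒≤length (covered v)) (s≤s (ball-length d v))
  where
  open Distance G conn
  open Branches G δ degree≤ {P = λ _ → ⊤} (λ _ → yes _)
  covered : ∀ v u → u ∈ v ∷ ball d v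
  covered v u with v ≟ u
  ... | yes refl = here refl
  ... | no v≢u   = there (∈-ball _ v≢u (dist v u , (dist-walk v u , λ _ → dist-min) , small v u))

-- From the number of colours to the gap.

tree-f : ∀ δ k → f k (suc δ) ≡ suc δ * tree δ k
tree-f δ k = cong (suc δ *_) (geometric k)
  where
  scale : ∀ n (h : ℕ → ℕ) → sum (applyUpTo (λ i → δ * h i) n) ≡ δ * sum (applyUpTo h n)
  scale zero    h = sym (*-zeroʳ δ)
  scale (suc n) h = trans (cong (_+_ (δ * h 0)) (scale n (h ∘ suc))) (sym (*-distribˡ-+ δ (h 0) _))
  -- Splitting off the term 1 leaves δ times the shorter sum, which is the recursion of `tree`.
  geometric : ∀ n → sum (map (δ ^_) (upTo n)) ≡ tree δ n
  geometric zero    = refl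
  geometric (suc n) = cong suc (trans (cong sum (map-applyUpTo suc (δ ^_) n))
    (trans (scale n (δ ^_)) (cong (δ *_) (trans (cong sum (sym (map-upTo (δ ^_) n))) (geometric n)))))

degree≤maxDegree : ∀ G v → degree G v ≤ maxDegree G
degree≤maxDegree G v = All.lookup (xs≤max 0 (map (degree G) (allFin _))) (∈-map⁺ (degree G) (∈-allFin v))

-- Subtract χ + 2 from both sides in ℤ: the 3 is the 1 of the gap plus the 2 of the bound.
gap-lower : ∀ k G → χ (power k G) + k ≤ f k (maxDegree G) + 3 → (+ k) - (+ 2) ℤ.≤ gap k G
gap-lower k G le = subst₂ ℤ._≤_ (lhs (+ χ (power k G)) (+ k)) (rhs (+ f k (maxDegree G)) (+ χ (power k G)))
  (ℤ.+-monoˡ-≤ (ℤ.- (+ χ (power k G) ℤ.+ + 2)) (ℤ.+≤+ le))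
  where
  open ℤ-Solver using (solve; con; _:+_; _:-_; _:=_)
  lhs : ∀ x y → (x ℤ.+ y) - (x ℤ.+ + 2) ≡ y - + 2
  lhs = solve 2 (λ x y → (x :+ y) :- (x :+ con (+ 2)) := y :- con (+ 2)) refl
  rhs : ∀ x y → (x ℤ.+ + 3) - (y ℤ.+ + 2) ≡ (x ℤ.+ + 1) - y
  rhs = solve 2 (λ x y → (x :+ con (+ 3)) :- (y :+ con (+ 2)) := (x :+ con (+ 1)) :- y) refl

largeDiameter-gap : (G : Graph) (conn : Connected G) → 3 ≤ maxDegree G → ∀ k → 1 ≤ k →
  ∀ u v → k + k ≤ Distance.dist G conn u v → (+ k) - (+ 2) ℤ.≤ gap k G
largeDiameter-gap G conn 3≤Δ k 1≤k u v far = gap-lower k G (go (maxDegree G) 3≤Δ (degree≤maxDegree G))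
  where
  go : ∀ Δ → 3 ≤ Δ → (∀ w → degree G w ≤ Δ) → χ (power k G) + k ≤ f k Δ + 3
  go (suc δ) (s≤s 2≤δ) degree≤ = subst (λ x → χ (power k G) + k ≤ x + 3) (sym (tree-f δ k)) (begin
    χ (power k G) + k                  ≤⟨ +-monoˡ-≤ k (proj₂ (proj₂ (chromatic (power k G))) (suc c) colourable) ⟩
    suc c + k                          ≡⟨ c-def ⟩
    suc δ * tree δ k + 3               ∎)
    where
    open ≤-Reasoning
    c : ℕ
    -- The subtraction is exact by `k≤` below.
    c = suc δ * tree δ k + 2 ∸ k
    k≤ : k ≤ suc δ * tree δ k + 2
    k≤ = ≤-trans (n≤tree (<⇒≤ 2≤δ) k) (≤-trans (m≤m+n (tree δ k) (δ * tree δ k)) (m≤m+n _ 2))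
    c-def : suc c + k ≡ suc δ * tree δ k + 3
    c-def = trans (cong suc (m∸n+n≡m k≤)) (sym (+-suc (suc δ * tree δ k) 2))
    colourable : Colourable (power k G) (suc c)
    colourable = LargeDiameter.power-colourable G conn δ degree≤ 2≤δ k 1≤k u v far c c-def

theorem4 : (k Δ : ℕ) → 1 ≤ k → 3 ≤ Δ →
    FinitelyManyUpToIso (λ G → Connected G × maxDegree G ≡ Δ × gap k G < (+ k) - (+ 2))
theorem4 k (suc δ) 1≤k 3≤Δ = boundedOrder-finite (suc (suc δ * tree δ (k + k))) _ bound
  where
  bound : ∀ G → Connected G × maxDegree G ≡ suc δ × gap k G < (+ k) - (+ 2) →
          Graph.order G ≤ suc (suc δ * tree δ (k + k))
  bound G (conn , maxDeg , small-gap) = smallDiameter-order G conn δ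
    (λ v → subst (degree G v ≤_) maxDeg (degree≤maxDegree G v)) (k + k)
    -- A distance of at least 2k would contradict the small gap, so 2k bounds all distances.
    λ u v → ≰⇒≥ λ far → ℤ.<⇒≱ small-gap
      (largeDiameter-gap G conn (subst (3 ≤_) (sym maxDeg) 3≤Δ) k 1≤k u v far)
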